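{- For every integer $n\ge 81$ there is a bipartite graph with $n$ vertices that is a unit rectangle visibility graph and has at least $4n-8\lceil\sqrt{n}\,\rceil+4$ edges.
   Context: A finite simple graph $G$ is a unit rectangle visibility graph (URVG) if its vertices $v$ can be represented by closed unit squares $S_v$ in the plane with sides parallel to the coordinate axes and with pairwise disjoint interiors (squares may touch along their boundaries), in such a way that two distinct vertices $v,w$ are adjacent if and only if there is an unobstructed non-degenerate (positive width) horizontal or vertical band of visibility joining $S_v$ and $S_w$. Here a horizontal band of visibility joining $S_v$ and $S_w$ is given by an open interval $I$ of positive length such that for every $y_0\in I$ the line $y=y_0$ meets the interiors of both $S_v$ and $S_w$, and the part of this line between $S_v$ and $S_w$ (possibly a single point if the squares touch) meets the interior of no other square of the representation; vertical bands are defined analogously with the roles of $x$ and $y$ exchanged. -}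

module Defs where

open import Data.Bool.Base using (Bool)
open import Data.Fin.Base using (Fin)
import Data.Fin.Properties as Fin
open import Data.List.Base using (length; filter; cartesianProduct; allFin)
open import Data.Nat.Base as ℕ using (ℕ; zero; suc)
import Data.Nat.Properties as ℕ
open import Data.Product using (Σ; ∃; ∃-syntax; _×_; _,_; proj₁; proj₂)
open import Data.Rational.Base as ℚ using (ℚ; 1ℚ)
import Data.Rational.Properties as ℚ
open import Data.Sum.Base using (_⊎_)
open import Function.Bundles using (_⇔_; mk⇔; Equivalence)
open import Relation.Binary.PropositionalEquality
open import Relation.Nullary using (¬_; Dec; yes; no)
open import Relation.Nullary.Decidable using (_×-dec_)

-- Real numbers as two-sided, located Dedekind cuts: L q means q < x and
-- U q means x < q.

record ℝ : Set₁ where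
  field
    L U         : ℚ → Set
    L-inhabited : ∃ L
    U-inhabited : ∃ U
    L-rounded   : ∀ q → L q ⇔ (∃[ r ] q ℚ.< r × L r)
    U-rounded   : ∀ q → U q ⇔ (∃[ r ] r ℚ.< q × U r)
    disjoint    : ∀ q → ¬ (L q × U q)
    located     : ∀ q r → q ℚ.< r → L q ⊎ U r

infix 4 _<_ _≤_

_<_ : ℝ → ℝ → Set
x < y = ∃[ q ] ℝ.U x q × ℝ.L y q

_≤_ : ℝ → ℝ → Set
x ≤ y = ¬ (y < x)

private
  cancel : ∀ q → (q ℚ.+ 1ℚ) ℚ.- 1ℚ ≡ q
  cancel q = trans (ℚ.+-assoc q 1ℚ (ℚ.- 1ℚ)) (ℚ.+-identityʳ q)

  cancel′ : ∀ q → (q ℚ.- 1ℚ) ℚ.+ 1ℚ ≡ q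
  cancel′ q = trans (ℚ.+-assoc q (ℚ.- 1ℚ) 1ℚ) (ℚ.+-identityʳ q)

-- x +1 is the real number x + 1. The plane is used only through its order and
-- through translation by the side length 1, so no other arithmetic is needed.

infixl 6 _+1

_+1 : ℝ → ℝ
x +1 = record
  { L           = λ q → L (q ℚ.- 1ℚ)
  ; U           = λ q → U (q ℚ.- 1ℚ)
  ; L-inhabited = proj₁ L-inhabited ℚ.+ 1ℚ , subst L (sym (cancel _)) (proj₂ L-inhabited)
  ; U-inhabited = proj₁ U-inhabited ℚ.+ 1ℚ , subst U (sym (cancel _)) (proj₂ U-inhabited)
  ; L-rounded   = λ q → mk⇔
      (λ Lq → let (r , q-1<r , Lr) = Equivalence.to (L-rounded (q ℚ.- 1ℚ)) Lq in
        r ℚ.+ 1ℚ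
        , subst (ℚ._< r ℚ.+ 1ℚ) (cancel′ q) (ℚ.+-monoˡ-< 1ℚ q-1<r)
        , subst L (sym (cancel r)) Lr)
      (λ { (r , q<r , Lr) → Equivalence.from (L-rounded (q ℚ.- 1ℚ))
        (r ℚ.- 1ℚ , ℚ.+-monoˡ-< (ℚ.- 1ℚ) q<r , Lr) })
  ; U-rounded   = λ q → mk⇔
      (λ Uq → let (r , r<q-1 , Ur) = Equivalence.to (U-rounded (q ℚ.- 1ℚ)) Uq in
        r ℚ.+ 1ℚ
        , subst (r ℚ.+ 1ℚ ℚ.<_) (cancel′ q) (ℚ.+-monoˡ-< 1ℚ r<q-1)
        , subst U (sym (cancel r)) Ur)
      (λ { (r , r<q , Ur) → Equivalence.from (U-rounded (q ℚ.- 1ℚ))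
        (r ℚ.- 1ℚ , ℚ.+-monoˡ-< (ℚ.- 1ℚ) r<q , Ur) })
  ; disjoint    = λ q → disjoint (q ℚ.- 1ℚ)
  ; located     = λ q r q<r →
      located (q ℚ.- 1ℚ) (r ℚ.- 1ℚ) (ℚ.+-monoˡ-< (ℚ.- 1ℚ) q<r)
  }
  where open ℝ x

record Graph (n : ℕ) : Set₁ where
  field
    Adj    : Fin n → Fin n → Set
    adj?   : ∀ v w → Dec (Adj v w)
    symm   : ∀ {v w} → Adj v w → Adj w v
    irrefl : ∀ {v} → ¬ Adj v v

-- Each edge {v , w} is counted once, as the pair with v < w.

edges : ∀ {n} → Graph n → ℕ
edges {n} G = length
  (filter (λ (v , w) → (v Fin.<? w) ×-dec Graph.adj? G v w)
          (cartesianProduct (allFin n) (allFin n)))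

Bipartite : ∀ {n} → Graph n → Set
Bipartite {n} G =
  Σ (Fin n → Bool) λ side → ∀ v w → Graph.Adj G v w → side v ≢ side w

-- The closed axis-parallel unit square with the given left and bottom sides.

record Square : Set₁ where
  constructor square
  field
    left bottom : ℝ

  right top : ℝ
  right = left +1
  top   = bottom +1

open Square

Interior : Square → ℝ → ℝ → Set
Interior S x y = (left S < x × x < right S) × (bottom S < y × y < top S)

Arrangement : ℕ → Set₁
Arrangement n = Fin n → Square

DisjointInteriors : ∀ {n} → Arrangement n → Set₁
DisjointInteriors S =
  ∀ v w → v ≢ w → ∀ x y → ¬ (Interior (S v) x y × Interior (S w) x y)

-- When the horizontal line at some height meets the interiors of both S and T,
-- these being disjoint, one square lies to the left of the other; the x
-- satisfying BetweenX S T are then the abscissae of the closed segment of that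
-- line between the two squares.

BetweenX : Square → Square → ℝ → Set
BetweenX S T x = (right S ≤ x × x ≤ left T) ⊎ (right T ≤ x × x ≤ left S)

HorizontalBand : ∀ {n} → Arrangement n → Fin n → Fin n → Set₁
HorizontalBand S v w =
  Σ ℝ λ a → Σ ℝ λ b → a < b ×
  (∀ y → a < y → y < b →
    (∃[ x ] Interior (S v) x y) ×
    (∃[ x ] Interior (S w) x y) ×
    (∀ u → u ≢ v → u ≢ w → ∀ x → BetweenX (S v) (S w) x → ¬ Interior (S u) x y))

transpose : Square → Square
transpose (square x y) = square y x

VerticalBand : ∀ {n} → Arrangement n → Fin n → Fin n → Set₁
VerticalBand S = HorizontalBand (λ v → transpose (S v))

Represents : ∀ {n} → Arrangement n → Graph n → Set₁
Represents S G =
  DisjointInteriors S ×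
  (∀ v w → v ≢ w → Graph.Adj G v w ⇔ (HorizontalBand S v w ⊎ VerticalBand S v w))

IsURVG : ∀ {n} → Graph n → Set₁
IsURVG {n} G = Σ (Arrangement n) λ S → Represents S G

-- bumpRoot n r is ⌈√ n ⌉ when r is ⌈√ (n - 1) ⌉.

bumpRoot : ℕ → ℕ → ℕ
bumpRoot n r with n ℕ.≤? r ℕ.* r
... | yes _ = r
... | no  _ = suc r

⌈√_⌉ : ℕ → ℕ
⌈√ zero ⌉  = zero
⌈√ suc n ⌉ = bumpRoot (suc n) ⌈√ n ⌉

-- ⌈√ n ⌉ is the least k with n ≤ k * k.

⌈√⌉-upper : ∀ n → n ℕ.≤ ⌈√ n ⌉ ℕ.* ⌈√ n ⌉
⌈√⌉-upper zero = ℕ.z≤n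
⌈√⌉-upper (suc n) with suc n ℕ.≤? ⌈√ n ⌉ ℕ.* ⌈√ n ⌉
... | yes p = p
... | no  _ = ℕ.s≤s (ℕ.≤-trans (⌈√⌉-upper n)
  (ℕ.≤-trans (ℕ.*-monoʳ-≤ ⌈√ n ⌉ (ℕ.n≤1+n ⌈√ n ⌉)) (ℕ.m≤n+m _ ⌈√ n ⌉)))

⌈√⌉-least : ∀ n k → n ℕ.≤ k ℕ.* k → ⌈√ n ⌉ ℕ.≤ k
⌈√⌉-least zero k _ = ℕ.z≤n
⌈√⌉-least (suc n) k n<k² with suc n ℕ.≤? ⌈√ n ⌉ ℕ.* ⌈√ n ⌉
... | yes _ = ⌈√⌉-least n k (ℕ.≤-trans (ℕ.n≤1+n n) n<k²)
... | no ¬p = ℕ.≰⇒> λ k≤r →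
  ¬p (ℕ.≤-trans n<k² (ℕ.*-mono-≤ k≤r k≤r))

-- In half units, put the lower left corner of the square in column c and row r at
-- the Gaussian integer (1 + 3i)(c + ri), that is, at x = c - 3r and y = 3c + r, and
-- number n squares row by row in rows of length k = ⌈√n⌉. In (column , row)
-- coordinates a square deep inside sees exactly its translates by ±(1 , 0) and
-- ±(2 , 1) vertically and by ±(0 , 1) and ±(-1 , 2) horizontally.
--
-- Along the boundary there may be more visibilities, but never between squares with
-- equal x or with equal y: the translates of the first one that cover its left and
-- right halves are present whenever the second one is. So the offset across every
-- band is odd, and since x and y have the same parity, the parity of x is a proper
-- 2-colouring.
--
-- Each of the four kinds of edges is missing at a vertex only near the boundary.
-- With at most k rows these exceptions number at most 8k - 4.

module Submission where

open import Defs hiding (_<_; _≤_)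
open import Data.Bool.Base using (Bool; true; not)
open import Data.Bool.Properties using (not-involutive; not-¬)
open import Data.Empty using (⊥; ⊥-elim)
open import Data.Fin.Base using (Fin; zero; suc; toℕ; fromℕ<)
import Data.Fin.Properties as Fin
open import Data.Integer.Base as ℤ using (ℤ; +_; +[1+_]; -[1+_]; 0ℤ; 1ℤ; -1ℤ)
import Data.Integer.DivMod as ℤ
import Data.Integer.Properties as ℤ
import Data.Integer.Tactic.RingSolver as ℤ
open import Data.List.Base
  using (List; []; _∷_; _++_; map; filter; length; lookup; concatMap; applyUpTo; upTo; allFin;
         cartesianProduct)
open import Data.List.Membership.Propositional using (_∈_)
open import Data.List.Membership.Propositional.Properties
import Data.List.Membership.Setoid.Properties as Setoid
open import Data.List.Properties using (length-++; length-map; length-upTo; length-applyUpTo)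
open import Data.List.Relation.Unary.All as All using ([]; _∷_)
open import Data.List.Relation.Unary.AllPairs using ([]; _∷_)
open import Data.List.Relation.Unary.Any as Any using (here; there)
open import Data.List.Relation.Unary.Unique.Propositional using (Unique)
open import Data.List.Relation.Unary.Unique.Propositional.Properties using (cartesianProduct⁺; upTo⁺)
open import Data.Nat.Base as ℕ using (ℕ; zero; suc)
open import Data.Nat.Divisibility using (n∣m*n)
import Data.Nat.DivMod as ℕ
open import Data.Nat.ListAction using (sum)
import Data.Nat.Properties as ℕ
import Data.Nat.Tactic.RingSolver as ℕ
open import Data.Product using (Σ; ∃-syntax; _×_; _,_; proj₁; proj₂)
open import Data.Rational.Base as ℚ using (ℚ; mkℚ; 1ℚ)
import Data.Rational.Properties as ℚ
open import Data.Rational.Unnormalised.Base as ℚᵘ using (mkℚᵘ)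
import Data.Rational.Unnormalised.Properties as ℚᵘ
open import Data.Sum.Base as Sum using (_⊎_; inj₁; inj₂)
open import Function.Base using (_∘_)
open import Function.Bundles using (mk⇔; Equivalence)
open import Relation.Binary.Definitions using (tri<; tri≈; tri>)
open import Relation.Binary.PropositionalEquality
open import Relation.Nullary using (¬_; Dec; yes; no; contradiction)
open import Relation.Nullary.Decidable
  using (_×-dec_; _⊎-dec_; _→-dec_; ¬?; map′; True; toWitness)

-- Bands between squares with half-integral coordinates

module _ where
  open Defs using (_<_; _≤_)

  -- half is opaque so that equations half a ≡ half b can be solved for a.
  opaque
    half : ℤ → ℚ
    half a = ℚ.fromℚᵘ (mkℚᵘ a 1)

    half-mono-< : ∀ {a b} → a ℤ.< b → half a ℚ.< half b
    half-mono-< {a} {b} a<b = ℚ.toℚᵘ-cancel-<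
      (ℚᵘ.<-respˡ-≃ (ℚᵘ.≃-sym (ℚ.toℚᵘ-fromℚᵘ (mkℚᵘ a 1)))
        (ℚᵘ.<-respʳ-≃ (ℚᵘ.≃-sym (ℚ.toℚᵘ-fromℚᵘ (mkℚᵘ b 1)))
          (ℚᵘ.*<* (ℤ.*-monoʳ-<-pos (+ 2) a<b))))

    half-2+ : ∀ a → half (+ 2 ℤ.+ a) ℚ.- 1ℚ ≡ half a
    half-2+ a = ℚ.toℚᵘ-injective (begin
      ℚ.toℚᵘ (half (+ 2 ℤ.+ a) ℚ.- 1ℚ)
        ≈⟨ ℚ.toℚᵘ-homo-+ (half (+ 2 ℤ.+ a)) (ℚ.- 1ℚ) ⟩
      ℚ.toℚᵘ (half (+ 2 ℤ.+ a)) ℚᵘ.- ℚᵘ.1ℚᵘ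
        ≈⟨ ℚᵘ.+-congˡ (ℚᵘ.- ℚᵘ.1ℚᵘ) (ℚ.toℚᵘ-fromℚᵘ (mkℚᵘ (+ 2 ℤ.+ a) 1)) ⟩
      mkℚᵘ (+ 2 ℤ.+ a) 1 ℚᵘ.- ℚᵘ.1ℚᵘ
        ≈⟨ ℚᵘ.*≡* (numerators a) ⟩
      mkℚᵘ a 1
        ≈⟨ ℚ.toℚᵘ-fromℚᵘ (mkℚᵘ a 1) ⟨
      ℚ.toℚᵘ (half a) ∎)
      where
      open ℚᵘ.≃-Reasoning
      numerators : ∀ a → ((+ 2 ℤ.+ a) ℤ.* + 1 ℤ.+ ℤ.- 1ℤ ℤ.* + 2) ℤ.* + 2 ≡ a ℤ.* + 2
      numerators = ℤ.solve-∀

    half-floor : ∀ q → ∃[ c ] half c ℚ.≤ q × q ℚ.< half (1ℤ ℤ.+ c)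
    half-floor q@(mkℚ n d-1 _) = c
      , ℚ.toℚᵘ-cancel-≤ (ℚᵘ.≤-respˡ-≃ (ℚᵘ.≃-sym (ℚ.toℚᵘ-fromℚᵘ (mkℚᵘ c 1)))
          (ℚᵘ.*≤* (ℤ.[n/ℕd]*d≤n (n ℤ.* + 2) (suc d-1))))
      , ℚ.toℚᵘ-cancel-< (ℚᵘ.<-respʳ-≃ (ℚᵘ.≃-sym (ℚ.toℚᵘ-fromℚᵘ (mkℚᵘ (1ℤ ℤ.+ c) 1)))
          (ℚᵘ.*<* (ℤ.n<s[n/ℕd]*d (n ℤ.* + 2) (suc d-1))))
      where
      c : ℤ
      c = (n ℤ.* + 2) ℤ./ℕ suc d-1

  half-mono-≤ : ∀ {a b} → a ℤ.≤ b → half a ℚ.≤ half b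
  half-mono-≤ {a} {b} a≤b with a ℤ.≟ b
  ... | yes refl = ℚ.≤-refl
  ... | no  a≢b  = ℚ.<⇒≤ (half-mono-< (ℤ.≤∧≢⇒< a≤b a≢b))

  half-cancel-< : ∀ {a b} → half a ℚ.< half b → a ℤ.< b
  half-cancel-< {a} {b} p = ℤ.≰⇒> λ b≤a →
    ℚ.<-irrefl refl (ℚ.<-≤-trans p (half-mono-≤ b≤a))

  ⊓-glb-< : ∀ {p q r} → p ℚ.< q → p ℚ.< r → p ℚ.< q ℚ.⊓ r
  ⊓-glb-< {p} {q} {r} p<q p<r with ℚ.⊓-sel q r
  ... | inj₁ eq = subst (p ℚ.<_) (sym eq) p<q
  ... | inj₂ eq = subst (p ℚ.<_) (sym eq) p<r

  -- Comparing reals with half-integers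

  fromℚ : ℚ → ℝ
  fromℚ p = record
    { L           = ℚ._< p
    ; U           = p ℚ.<_
    ; L-inhabited = p ℚ.- 1ℚ
        , subst (p ℚ.- 1ℚ ℚ.<_) (ℚ.+-identityʳ p) (ℚ.+-monoʳ-< p (ℚ.negative⁻¹ (ℚ.- 1ℚ)))
    ; U-inhabited = p ℚ.+ 1ℚ
        , subst (ℚ._< p ℚ.+ 1ℚ) (ℚ.+-identityʳ p) (ℚ.+-monoʳ-< p (ℚ.positive⁻¹ 1ℚ))
    ; L-rounded   = λ q → mk⇔ ℚ.<-dense λ (_ , q<r , r<p) → ℚ.<-trans q<r r<p
    ; U-rounded   = λ q → mk⇔ (λ p<q → let (r , p<r , r<q) = ℚ.<-dense p<q in r , r<q , p<r)
        λ (_ , r<q , p<r) → ℚ.<-trans p<r r<q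
    ; disjoint    = λ q (q<p , p<q) → ℚ.<-asym q<p p<q
    ; located     = located
    }
    where
    located : ∀ q r → q ℚ.< r → q ℚ.< p ⊎ p ℚ.< r
    located q r q<r with q ℚ.<? p
    ... | yes q<p = inj₁ q<p
    ... | no  q≮p = inj₂ (ℚ.≤-<-trans (ℚ.≮⇒≥ q≮p) q<r)

  module _ (x : ℝ) where
    open ℝ x

    L-lower : ∀ {p q} → p ℚ.≤ q → L q → L p
    L-lower p≤q Lq = let (r , q<r , Lr) = Equivalence.to (L-rounded _) Lq in
      Equivalence.from (L-rounded _) (r , ℚ.≤-<-trans p≤q q<r , Lr)

    U-upper : ∀ {p q} → p ℚ.≤ q → U p → U q
    U-upper p≤q Up = let (r , r<p , Ur) = Equivalence.to (U-rounded _) Up in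
      Equivalence.from (U-rounded _) (r , ℚ.<-≤-trans r<p p≤q , Ur)

    L<U : ∀ {p q} → L p → U q → p ℚ.< q
    L<U Lp Uq = ℚ.≰⇒> λ q≤p → disjoint _ (Lp , U-upper q≤p Uq)

    fromℚ-< : ∀ {q} → L q → fromℚ q < x
    fromℚ-< Lq = Equivalence.to (L-rounded _) Lq

    fromℚ-<⁻ : ∀ {q} → fromℚ q < x → L q
    fromℚ-<⁻ p = Equivalence.from (L-rounded _) p

    <-fromℚ⁻ : ∀ {q} → x < fromℚ q → U q
    <-fromℚ⁻ (r , Ur , r<q) = Equivalence.from (U-rounded _) (r , r<q , Ur)

    <-half+1 : ∀ {a} → U (half (+ 2 ℤ.+ a)) → x < fromℚ (half a) +1
    <-half+1 {a} Ua = let (r , r<a+2 , Ur) = Equivalence.to (U-rounded _) Ua in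
      r , Ur , subst (r ℚ.- 1ℚ ℚ.<_) (half-2+ a) (ℚ.+-monoˡ-< (ℚ.- 1ℚ) r<a+2)

    <-half+1⁻ : ∀ {a} → x < fromℚ (half a) +1 → U (half (+ 2 ℤ.+ a))
    <-half+1⁻ {a} (r , Ur , r-1<a) = U-upper
      (ℚ.<⇒≤ (ℚ.≰⇒> λ a+2≤r → ℚ.<-irrefl refl (ℚ.≤-<-trans
        (subst (ℚ._≤ r ℚ.- 1ℚ) (half-2+ a) (ℚ.+-monoˡ-≤ (ℚ.- 1ℚ) a+2≤r)) r-1<a))) Ur

  i<1+i : ∀ i → i ℤ.< 1ℤ ℤ.+ i
  i<1+i i = ℤ.suc[i]≤j⇒i<j ℤ.≤-refl

  i<1+j⇒i≤j : ∀ {i j} → i ℤ.< 1ℤ ℤ.+ j → i ℤ.≤ j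
  i<1+j⇒i≤j {i} {j} p = ℤ.≮⇒≥ λ j<i → ℤ.<-irrefl refl (ℤ.<-≤-trans p (ℤ.i<j⇒suc[i]≤j j<i))

  2+i≡1+1+i : ∀ i → + 2 ℤ.+ i ≡ 1ℤ ℤ.+ (1ℤ ℤ.+ i)
  2+i≡1+1+i = ℤ.solve-∀

  1+i<2+i : ∀ i → 1ℤ ℤ.+ i ℤ.< + 2 ℤ.+ i
  1+i<2+i i = subst (1ℤ ℤ.+ i ℤ.<_) (sym (2+i≡1+1+i i)) (i<1+i (1ℤ ℤ.+ i))

  i<2+i : ∀ i → i ℤ.< + 2 ℤ.+ i
  i<2+i i = ℤ.<-trans (i<1+i i) (1+i<2+i i)

  -- In half units a unit square with left side a covers the two cells
  -- (a , 1 + a) and (1 + a , 2 + a); a cell is named by its lower end.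

  Covers : ℤ → ℤ → Set
  Covers a c = a ℤ.≤ c × c ℤ.< + 2 ℤ.+ a

  covers? : ∀ a c → Dec (Covers a c)
  covers? a c = (a ℤ.≤? c) ×-dec (c ℤ.<? (+ 2 ℤ.+ a))

  two-cells : ∀ {a c} → Covers a c → c ≡ a ⊎ c ≡ 1ℤ ℤ.+ a
  two-cells {a} {c} (a≤c , c<2+a) with a ℤ.≟ c
  ... | yes a≡c = inj₁ (sym a≡c)
  ... | no  a≢c = inj₂ (ℤ.≤-antisym
    (i<1+j⇒i≤j (subst (c ℤ.<_) (2+i≡1+1+i a) c<2+a))
    (ℤ.i<j⇒suc[i]≤j (ℤ.≤∧≢⇒< a≤c a≢c)))

  -- In half units this is |a - b| ≤ 1: the open unit intervals starting at `a` and `b` overlap.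
  Near : ℤ → ℤ → Set
  Near a b = a ℤ.< + 2 ℤ.+ b × b ℤ.< + 2 ℤ.+ a

  near : ∀ {a b c} → Covers a c → Covers b c → Near a b
  near (a≤c , c<a) (b≤c , c<b) = ℤ.≤-<-trans a≤c c<b , ℤ.≤-<-trans b≤c c<a

  -- The squares are given by the doubles of their coordinates, P in the direction
  -- of the bands and Q across it. Separated says that interiors are disjoint.

  module _ {n : ℕ} (P Q : Fin n → ℤ) where

    halves : Arrangement n
    halves v = square (fromℚ (half (P v))) (fromℚ (half (Q v)))

    Separated : Set
    Separated = ∀ {u v} → Near (P u) (P v) → Near (Q u) (Q v) → u ≡ v

    Between : Fin n → Fin n → Fin n → Set
    Between v u w = (P v ℤ.< P u × P u ℤ.< P w) ⊎ (P w ℤ.< P u × P u ℤ.< P v)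

    Clear : Fin n → Fin n → ℤ → Set
    Clear v w c = Covers (Q v) c × Covers (Q w) c × (∀ u → Covers (Q u) c → ¬ Between v u w)

    -- One line of a band avoids the half-integers, and then the whole open cell
    -- around it is a band.
    Visible : Fin n → Fin n → Set
    Visible v w = ∃[ c ] Clear v w c

    clear? : ∀ v w c → Dec (Clear v w c)
    clear? v w c = covers? (Q v) c ×-dec (covers? (Q w) c ×-dec Fin.all? λ u →
      covers? (Q u) c →-dec ¬? (((P v ℤ.<? P u) ×-dec (P u ℤ.<? P w))
        ⊎-dec ((P w ℤ.<? P u) ×-dec (P u ℤ.<? P v))))

    -- A witnessing cell is covered by `v`, so only the two cells of `v` have to be tried.
    visible? : ∀ v w → Dec (Visible v w)
    visible? v w = map′
      Sum.[ _ ,_ , _ ,_ ]′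
      (λ (c , clear) → Sum.map (λ c≡ → subst (Clear v w) c≡ clear)
                               (λ c≡ → subst (Clear v w) c≡ clear) (two-cells (proj₁ clear)))
      (clear? v w (Q v) ⊎-dec clear? v w (1ℤ ℤ.+ Q v))

    visible-sym : ∀ {v w} → Visible v w → Visible w v
    visible-sym (c , cv , cw , free) = c , cw , cv , λ u cu → free u cu ∘ Sum.swap

    module _ (sep : Separated) where

      halves-disjoint : DisjointInteriors halves
      halves-disjoint v w v≢w x y
        (((vx , xv) , (vy , yv)) , ((wx , xw) , (wy , yw))) = v≢w (sep
          (reach x vx xw , reach x wx xv) (reach y vy yw , reach y wy yv))
        where
        reach : ∀ {a b} z → fromℚ (half a) < z → z < fromℚ (half b) +1 → a ℤ.< + 2 ℤ.+ b
        reach z az zb = half-cancel-< (L<U z (fromℚ-<⁻ z az) (<-half+1⁻ z zb))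

      -- A common cell makes the squares near across the bands, so separation keeps them from being
      -- near along the bands. Hence comparing left sides, as `Between` does, compares whole
      -- squares.
      gap : ∀ {v w c} → Covers (Q v) c → Covers (Q w) c → P v ℤ.< P w → + 2 ℤ.+ P v ℤ.≤ P w
      gap {v} {w} cv cw v<w = ℤ.≮⇒≥ λ w<2+v → ℤ.<-irrefl
        (cong P (sep (ℤ.<-trans v<w (i<2+i (P w)) , w<2+v) (near cv cw))) v<w

      -- The whole open cell serves as the band: a square whose interior meets a line through it
      -- covers the cell, and `Clear` excludes such a square between `v` and `w`.
      visible⇒band : ∀ {v w} → Visible v w → HorizontalBand halves v w
      visible⇒band {v} {w} (c , cv , cw , free) =
        fromℚ (half c) , fromℚ (half (1ℤ ℤ.+ c)) , ℚ.<-dense (half-mono-< (i<1+i c)) ,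
        λ y c<y y<1+c → let Ly = fromℚ-<⁻ y c<y ; Uy = <-fromℚ⁻ y y<1+c in
          inside v y cv Ly Uy , inside w y cw Ly Uy , λ u _ _ x betw inu → blocked y Ly Uy u x betw inu
        where
        height : ∀ {a} y → Covers a c → ℝ.L y (half c) → ℝ.U y (half (1ℤ ℤ.+ c)) →
                 fromℚ (half a) < y × y < fromℚ (half a) +1
        height {a} y (a≤c , c<2+a) Ly Uy = fromℚ-< y (L-lower y (half-mono-≤ a≤c) Ly)
          , <-half+1 y (U-upper y (half-mono-≤ (ℤ.i<j⇒suc[i]≤j c<2+a)) Uy)

        inside : ∀ v y → Covers (Q v) c → ℝ.L y (half c) → ℝ.U y (half (1ℤ ℤ.+ c)) →
                 ∃[ x ] Interior (halves v) x y
        inside v y cv Ly Uy = x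
          , (fromℚ-< x (half-mono-< (i<1+i (P v))) , <-half+1 x (half-mono-< (1+i<2+i (P v))))
          , height y cv Ly Uy
          where x = fromℚ (half (1ℤ ℤ.+ P v))

        order : ∀ {a b} x → fromℚ (half a) +1 ≤ x → x < fromℚ (half b) +1 → a ℤ.< b
        order x a≤x x<b = ℤ.≰⇒> λ b≤a →
          a≤x (<-half+1 x (U-upper x (half-mono-≤ (ℤ.+-monoʳ-≤ (+ 2) b≤a)) (<-half+1⁻ x x<b)))

        order′ : ∀ {a b} x → fromℚ (half a) < x → x ≤ fromℚ (half b) → a ℤ.< b
        order′ x a<x x≤b = ℤ.≰⇒> λ b≤a →
          x≤b (fromℚ-< x (L-lower x (half-mono-≤ b≤a) (fromℚ-<⁻ x a<x)))

        blocked : ∀ y → ℝ.L y (half c) → ℝ.U y (half (1ℤ ℤ.+ c)) → ∀ u x →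
                  BetweenX (halves v) (halves w) x → ¬ Interior (halves u) x y
        blocked y Ly Uy u x betw ((ux , xu) , (uy , yu)) = free u cu
          (Sum.map (λ (vx , xw) → order x vx xu , order′ x ux xw)
                   (λ (wx , xv) → order x wx xu , order′ x ux xv) betw)
          where
          cu : Covers (Q u) c
          cu = i<1+j⇒i≤j (half-cancel-< (L<U y (fromℚ-<⁻ y uy) Uy))
             , half-cancel-< (L<U y Ly (<-half+1⁻ y yu))

      -- One line of the band suffices if it runs strictly inside a cell: the squares whose
      -- interiors it meets are then those that cover the cell.
      band⇒visible : ∀ {v w} → HorizontalBand halves v w → Visible v w
      band⇒visible {v} {w} (a , b , (q , Uaq , Lbq) , band)
        -- `q` may be a half-integer. Moving up to `s`, below both `r` and the top of the cell of
        -- `q`, stays in the band and gives half c ≤ q < s < half (1 + c).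
        with r , q<r , Lbr ← Equivalence.to (ℝ.L-rounded b q) Lbq
        with c , c≤q , q<1+c ← half-floor q
        with s , q<s , s<m ← ℚ.<-dense (⊓-glb-< q<r q<1+c)
        = c , cv , cw , unblocked
        where
        s<1+c : s ℚ.< half (1ℤ ℤ.+ c)
        s<1+c = ℚ.<-≤-trans s<m (ℚ.p⊓q≤q r _)

        y : ℝ
        y = fromℚ s

        at-y = band y (q , Uaq , q<s) (r , ℚ.<-≤-trans s<m (ℚ.p⊓q≤p r _) , Lbr)

        covers : ∀ u → ∃[ x ] Interior (halves u) x y → Covers (Q u) c
        covers u (_ , _ , (uy , yu)) =
            i<1+j⇒i≤j (half-cancel-< (ℚ.<-trans (fromℚ-<⁻ y uy) s<1+c))
          , half-cancel-< (ℚ.≤-<-trans c≤q (ℚ.<-trans q<s (<-half+1⁻ y yu)))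

        cv = covers v (proj₁ at-y)
        cw = covers w (proj₁ (proj₂ at-y))

        unblocked : ∀ u → Covers (Q u) c → ¬ Between v u w
        unblocked u cu betw = proj₂ (proj₂ at-y) u
          (λ { refl → Sum.[ ℤ.<-irrefl refl ∘ proj₁ , ℤ.<-irrefl refl ∘ proj₂ ]′ betw })
          (λ { refl → Sum.[ ℤ.<-irrefl refl ∘ proj₂ , ℤ.<-irrefl refl ∘ proj₁ ]′ betw })
          x
          (Sum.map (λ (v<u , u<w) → right≤ (gap cv cu v<u) , ≤left (gap cu cw u<w))
                   (λ (w<u , u<v) → right≤ (gap cw cu w<u) , ≤left (gap cu cv u<v)) betw)
          ( (fromℚ-< x (half-mono-< (i<1+i (P u))) , <-half+1 x (half-mono-< (1+i<2+i (P u))))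
          , fromℚ-< y (ℚ.≤-<-trans (half-mono-≤ (proj₁ cu)) (ℚ.≤-<-trans c≤q q<s))
          , <-half+1 y (ℚ.<-≤-trans s<1+c (half-mono-≤ (ℤ.i<j⇒suc[i]≤j (proj₂ cu)))))
          where
          -- The abscissa of the centre of `u`; by `gap` all of `u` lies between `v` and `w`.
          x : ℝ
          x = fromℚ (half (1ℤ ℤ.+ P u))

          right≤ : ∀ {a} → + 2 ℤ.+ a ℤ.≤ P u → fromℚ (half a) +1 ≤ x
          right≤ 2+a≤u x<a = ℤ.<-irrefl refl (ℤ.<-≤-trans
            (half-cancel-< (<-half+1⁻ x x<a)) (ℤ.≤-trans 2+a≤u (ℤ.<⇒≤ (i<1+i (P u)))))

          ≤left : ∀ {a} → + 2 ℤ.+ P u ℤ.≤ a → x ≤ fromℚ (half a)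
          ≤left 2+u≤a a<x = ℤ.<-irrefl refl (ℤ.<-≤-trans
            (half-cancel-< (fromℚ-<⁻ x a<x)) (ℤ.≤-trans (ℤ.<⇒≤ (1+i<2+i (P u))) 2+u≤a))

-- Lattices of squares

module _ where
  open import Data.Integer.Base hiding (suc; +_; +[1+_]; -[1+_]; 0ℤ; 1ℤ; -1ℤ; ℤ)
  open import Data.Integer.Properties

  i<j+k⇒i-k<j : ∀ {i} j k → i < j + k → i - k < j
  i<j+k⇒i-k<j {i} j k p = subst (i - k <_) (cancel j k) (+-monoˡ-< (- k) p)
    where
    cancel : ∀ j k → j + k - k ≡ j
    cancel = ℤ.solve-∀

  neg-swap : ∀ i j → - (j - i) ≡ i - j
  neg-swap = ℤ.solve-∀

  near-bounds : ∀ {a b} → Near a b → -[1+ 1 ] < a - b × a - b < + 2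
  near-bounds {a} {b} (a<2+b , b<2+a) =
      subst (-[1+ 1 ] <_) (neg-swap a b) (neg-mono-< (i<j+k⇒i-k<j (+ 2) a b<2+a))
    , i<j+k⇒i-k<j (+ 2) b a<2+b

  near-difference : ∀ {a b} → Near a b → a - b ≡ 0ℤ ⊎ a - b ≡ 1ℤ ⊎ a - b ≡ -1ℤ
  near-difference {a} {b} a~b = cases (a - b) (near-bounds a~b)
    where
    cases : ∀ d → -[1+ 1 ] < d × d < + 2 → d ≡ 0ℤ ⊎ d ≡ 1ℤ ⊎ d ≡ -1ℤ
    cases (+ 0)        _                             = inj₁ refl
    cases (+ 1)        _                             = inj₂ (inj₁ refl)
    cases +[1+ suc _ ] (_ , +<+ (ℕ.s≤s (ℕ.s≤s ())))
    cases -[1+ 0 ]     _                             = inj₂ (inj₂ refl)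
    cases -[1+ suc _ ] (-<- (ℕ.s≤s ()) , _)

  -- The implicit hypotheses confine l and h to a gap of the residue class of a
  -- modulo 10. They are decided by evaluation wherever a, k, l and h are numerals.
  no-residue-between : ∀ a k {l h} {_ : True (a + + 10 * k ≤? l)}
                       {_ : True (h ≤? a + + 10 * (1ℤ + k))} →
                       ∀ z → l < a + + 10 * z → a + + 10 * z < h → ⊥
  no-residue-between a k {_} {_} {p} {q} z l<z z<h = <-irrefl refl (<-≤-trans
    (cancel z (1ℤ + k) (<-≤-trans z<h (toWitness q)))
    (i<j⇒suc[i]≤j (cancel k z (≤-<-trans (toWitness p) l<z))))
    where
    cancel : ∀ i j → a + + 10 * i < a + + 10 * j → i < j
    cancel i j p = *-cancelˡ-<-nonNeg (+ 10) (subst₂ _<_ (minus a (+ 10 * i)) (minus a (+ 10 * j))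
      (+-monoʳ-< (- a) p))
      where
      minus : ∀ a b → - a + (a + b) ≡ b
      minus = ℤ.solve-∀

  i-j≡k⇒i≡k+j : ∀ {i j k} → i - j ≡ k → i ≡ k + j
  i-j≡k⇒i≡k+j {i} {j} refl = lemma i j
    where
    lemma : ∀ i j → i ≡ i - j + j
    lemma = ℤ.solve-∀

  i≡k+j⇒i-j≡k : ∀ {i j k} → i ≡ k + j → i - j ≡ k
  i≡k+j⇒i-j≡k {i} {j} {k} refl = lemma k j
    where
    lemma : ∀ k j → k + j - j ≡ k
    lemma = ℤ.solve-∀

  i≡k+j⇒j<i : ∀ {i j k} → i ≡ +[1+ k ] + j → j < i
  i≡k+j⇒j<i {j = j} {k} refl = subst (_< +[1+ k ] + j) (+-identityˡ j) (+-monoˡ-< j (+<+ (ℕ.s≤s ℕ.z≤n)))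

  covers-left : ∀ a → Covers a a
  covers-left a = ≤-refl , i<2+i a

  covers-right : ∀ a → Covers a (1ℤ + a)
  covers-right a = <⇒≤ (i<1+i a) , 1+i<2+i a

  -- Along the bands (P) and across them (Q), the squares form the lattice spanned
  -- by (3 , 1) and (10 , 0).
  module Lattice {n : ℕ} (P Q : Fin n → ℤ)
    (slope : ∀ u v → ∃[ z ] P u - P v ≡ + 3 * (Q u - Q v) + + 10 * z)
    (injective : ∀ {u v} → P u ≡ P v → Q u ≡ Q v → u ≡ v)
    where

    slope-at : ∀ u v {q} → Q u - Q v ≡ q → ∃[ z ] P u - P v ≡ + 3 * q + + 10 * z
    slope-at u v refl = slope u v

    -- For near squares the Q-difference is 0 or ±1, so the P-difference is 0 or ±3 modulo 10
    -- respectively. Strictly between -2 and 2 this leaves only 0, with equal Q.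
    separated : Separated P Q
    separated {u} {v} nearP nearQ with near-bounds nearP | near-difference nearQ
    ... | l , h | inj₂ (inj₁ q≡1) with z , eq ← slope-at u v q≡1 =
      ⊥-elim (no-residue-between (+ 3) -1ℤ z (subst (-[1+ 1 ] <_) eq l) (subst (_< + 2) eq h))
    ... | l , h | inj₂ (inj₂ q≡-1) with z , eq ← slope-at u v q≡-1 =
      ⊥-elim (no-residue-between -[1+ 2 ] 0ℤ z (subst (-[1+ 1 ] <_) eq l) (subst (_< + 2) eq h))
    ... | l , h | inj₁ q≡0 with z , eq ← slope-at u v q≡0 with <-cmp (P u - P v) 0ℤ
    ... | tri≈ _ p≡0 _ = injective (i-j≡0⇒i≡j _ _ p≡0) (i-j≡0⇒i≡j _ _ q≡0)
    ... | tri< p<0 _ _ = ⊥-elim (no-residue-between 0ℤ -1ℤ z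
      (subst (-[1+ 1 ] <_) eq l) (subst (_< 0ℤ) eq p<0))
    ... | tri> _ _ p>0 = ⊥-elim (no-residue-between 0ℤ 0ℤ z
      (subst (0ℤ <_) eq p>0) (subst (_< + 2) eq h))

    between-< : ∀ {v u w} → P v < P w → Between P Q v u w → P v < P u × P u < P w
    between-< v<w (inj₁ v<u<w)        = v<u<w
    between-< v<w (inj₂ (w<u , u<v)) = ⊥-elim (<-asym v<w (<-trans w<u u<v))

    offset : ∀ u v → Covers (Q u) (Q v) → Q u - Q v ≡ 0ℤ ⊎ Q u - Q v ≡ -1ℤ
    offset u v cov = Sum.map (i≡j⇒i-j≡0 ∘ sym)
      (λ e → trans (sym (neg-swap (Q u) (Q v))) (cong -_ (i≡k+j⇒i-j≡k e)))
      (two-cells cov)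

    -- The common cell is the upper one of `v` and the lower one of `w`. A blocker would precede `w`
    -- by 1 or 2, but covering the cell forces the difference to be 0 or -3 modulo 10. This holds in
    -- any finite part of the lattice.
    visible-3 : ∀ {v w} → P w ≡ + 3 + P v → Q w ≡ 1ℤ + Q v → Visible P Q v w
    visible-3 {v} {w} P≡ Q≡ = Q w , subst (Covers (Q v)) (sym Q≡) (covers-right (Q v))
      , covers-left (Q w) , λ u cu betw → blocked u cu (between-< (i≡k+j⇒j<i P≡) betw)
      where
      blocked : ∀ u → Covers (Q u) (Q w) → P v < P u × P u < P w → ⊥
      blocked u cu (v<u , u<w)
        with l ← subst (_< P u - P w) (trans (sym (neg-swap (P v) (P w))) (cong -_ (i≡k+j⇒i-j≡k P≡)))
                   (+-monoˡ-< (- P w) v<u)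
        with h ← subst (P u - P w <_) (+-inverseʳ (P w)) (+-monoˡ-< (- P w) u<w)
        with offset u w cu
      ... | inj₁ q≡0 with z , eq ← slope-at u w q≡0 =
        no-residue-between 0ℤ -1ℤ z (subst (-[1+ 2 ] <_) eq l) (subst (_< 0ℤ) eq h)
      ... | inj₂ q≡-1 with z , eq ← slope-at u w q≡-1 =
        no-residue-between -[1+ 2 ] 0ℤ z (subst (-[1+ 2 ] <_) eq l) (subst (_< 0ℤ) eq h)

    -- Now the common cell is the lower one of `v`, and a blocker would exceed `P v` by 1 to 6,
    -- against the residues 0 and 7 modulo 10.
    visible-7 : ∀ {v w} → P w ≡ + 7 + P v → Q v ≡ 1ℤ + Q w → Visible P Q v w
    visible-7 {v} {w} P≡ Q≡ = Q v , covers-left (Q v)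
      , subst (Covers (Q w)) (sym Q≡) (covers-right (Q w))
      , λ u cu betw → blocked u cu (between-< (i≡k+j⇒j<i P≡) betw)
      where
      blocked : ∀ u → Covers (Q u) (Q v) → P v < P u × P u < P w → ⊥
      blocked u cu (v<u , u<w)
        with l ← subst (_< P u - P v) (+-inverseʳ (P v)) (+-monoˡ-< (- P v) v<u)
        with h ← subst (P u - P v <_) (i≡k+j⇒i-j≡k P≡) (+-monoˡ-< (- P v) u<w)
        with offset u v cu
      ... | inj₁ q≡0 with z , eq ← slope-at u v q≡0 =
        no-residue-between 0ℤ 0ℤ z (subst (0ℤ <_) eq l) (subst (_< + 7) eq h)
      ... | inj₂ q≡-1 with z , eq ← slope-at u v q≡-1 =
        no-residue-between -[1+ 2 ] 0ℤ z (subst (0ℤ <_) eq l) (subst (_< + 7) eq h)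

    module Filled
      (fill-3 : ∀ {v w} → Q v ≡ Q w → P v < P w → ∃[ u ] P u ≡ + 3 + P v × Q u ≡ 1ℤ + Q v)
      (fill-7 : ∀ {v w} → Q v ≡ Q w → P v < P w → ∃[ u ] P u ≡ + 7 + P v × Q v ≡ 1ℤ + Q u)
      where

      far : ∀ {v w} → Q v ≡ Q w → P v < P w → + 7 + P v < P w
      far {v} {w} Qv≡Qw v<w with z , eq ← slope-at w v (i≡j⇒i-j≡0 (sym Qv≡Qw)) = ≰⇒> λ w≤7+v →
        no-residue-between 0ℤ 0ℤ z
          (subst (0ℤ <_) eq (subst (_< P w - P v) (+-inverseʳ (P v)) (+-monoˡ-< (- P v) v<w)))
          (subst (_< + 8) eq (i<j+k⇒i-k<j (+ 8) (P v)
            (≤-<-trans w≤7+v (+-monoˡ-< (P v) (+<+ ℕ.≤-refl)))))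

      -- Squares with equal Q are at least 10 apart along P. The translate of `v` by (7 , -1) covers
      -- the lower cell of `v`, the one by (3 , 1) the upper cell, and both come before `w`.
      hidden : ∀ {v w} → Q v ≡ Q w → P v < P w → ¬ Visible P Q v w
      hidden {v} {w} Qv≡Qw v<w (c , cv , cw , free) with two-cells cv
      ... | inj₁ refl with u , P≡ , Q≡ ← fill-7 Qv≡Qw v<w =
        free u (subst (Covers (Q u)) (sym Q≡) (covers-right (Q u)))
          (inj₁ (i≡k+j⇒j<i P≡ , subst (_< P w) (sym P≡) (far Qv≡Qw v<w)))
      ... | inj₂ refl with u , P≡ , Q≡ ← fill-3 Qv≡Qw v<w =
        free u (subst (Covers (Q u)) Q≡ (covers-left (Q u)))
          (inj₁ (i≡k+j⇒j<i P≡ , subst (_< P w) (sym P≡)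
            (≤-<-trans (+-monoˡ-≤ (P v) (+≤+ (ℕ.m≤m+n 3 4))) (far Qv≡Qw v<w))))

      visible-odd : ∀ {v w} → v ≢ w → Visible P Q v w → Q w ≡ 1ℤ + Q v ⊎ Q v ≡ 1ℤ + Q w
      visible-odd {v} {w} v≢w vis@(_ , cv , cw , _) with near-difference (near cv cw)
      ... | inj₂ (inj₁ q≡1) = inj₂ (i-j≡k⇒i≡k+j q≡1)
      ... | inj₂ (inj₂ q≡-1) = inj₁ (i-j≡k⇒i≡k+j
        (trans (sym (neg-swap (Q w) (Q v))) (cong -_ q≡-1)))
      ... | inj₁ q≡0 with Qv≡Qw ← i-j≡0⇒i≡j _ _ q≡0 with <-cmp (P v) (P w)
      ... | tri< v<w _ _ = contradiction vis (hidden Qv≡Qw v<w)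
      ... | tri≈ _ v≡w _ = contradiction (injective v≡w Qv≡Qw) v≢w
      ... | tri> _ _ w<v = contradiction (visible-sym P Q vis) (hidden (sym Qv≡Qw) w<v)

  -- Parity of integers

  even : ℕ → Bool
  even zero    = true
  even (suc n) = not (even n)

  parity : ℤ → Bool
  parity (+ n)      = even n
  parity (-[1+ n ]) = not (even n)

  parity-suc : ∀ i → parity (1ℤ + i) ≡ not (parity i)
  parity-suc (+ n)          = refl
  parity-suc (-[1+ zero ])  = refl
  parity-suc (-[1+ suc n ]) = sym (not-involutive (not (even n)))

  parity-2+ : ∀ i → parity (+ 2 + i) ≡ parity i
  parity-2+ i = begin
    parity (+ 2 + i)            ≡⟨ cong parity (2+i≡1+1+i i) ⟩
    parity (1ℤ + (1ℤ + i))      ≡⟨ parity-suc (1ℤ + i) ⟩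
    not (parity (1ℤ + i))       ≡⟨ cong not (parity-suc i) ⟩
    not (not (parity i))        ≡⟨ not-involutive (parity i) ⟩
    parity i                    ∎
    where open ≡-Reasoning

  parity-2*+ : ∀ m i → parity (+ 2 * + m + i) ≡ parity i
  parity-2*+ zero    i = cong parity (+-identityˡ i)
  parity-2*+ (suc m) i = trans (cong parity (rearrange (+ m) i))
    (trans (parity-2+ (+ 2 * + m + i)) (parity-2*+ m i))
    where
    rearrange : ∀ m i → + 2 * (1ℤ + m) + i ≡ + 2 + (+ 2 * m + i)
    rearrange = ℤ.solve-∀

  -- The arrangement by Gaussian integers

  10r : ∀ c r → + 10 * r ≡ + 3 * c + r - + 3 * (c - + 3 * r)
  10r = ℤ.solve-∀

  10c : ∀ c r → + 10 * c ≡ c - + 3 * r + + 3 * (+ 3 * c + r)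
  10c = ℤ.solve-∀

  -- This is y - 3x = 10r for differences; likewise `slope-H` is x + 3y = 10c.
  slope-V : ∀ c r c′ r′ → + 3 * c + r - (+ 3 * c′ + r′) ≡
            + 3 * (c - + 3 * r - (c′ - + 3 * r′)) + + 10 * (r - r′)
  slope-V = ℤ.solve-∀

  slope-H : ∀ c r c′ r′ → - (c - + 3 * r) - - (c′ - + 3 * r′) ≡
            + 3 * (+ 3 * c + r - (+ 3 * c′ + r′)) + + 10 * (c′ - c)
  slope-H = ℤ.solve-∀

  module Brick (n k : ℕ) .{{_ : ℕ.NonZero k}} where

    opaque
      col row : Fin n → ℕ
      col v = toℕ v ℕ.% k
      row v = toℕ v ℕ./ k

      col<k : ∀ v → col v ℕ.< k
      col<k v = ℕ.m%n<n (toℕ v) k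

      index : ∀ v → toℕ v ≡ col v ℕ.+ row v ℕ.* k
      index v = ℕ.m≡m%n+[m/n]*n (toℕ v) k

      -- The squares occupy an initial segment of the numbering, so any position numbered no later
      -- than an existing square is occupied.
      vertex : ∀ c r (w : Fin n) → c ℕ.< k → c ℕ.+ r ℕ.* k ℕ.≤ toℕ w →
               ∃[ u ] col u ≡ c × row u ≡ r × toℕ u ≡ c ℕ.+ r ℕ.* k
      vertex c r w c<k u≤w = fromℕ< u<n
        , trans (cong (ℕ._% k) toℕ≡) (trans (ℕ.[m+kn]%n≡m%n c r k) (ℕ.m<n⇒m%n≡m c<k))
        , trans (cong (ℕ._/ k) toℕ≡) (trans (ℕ.+-distrib-/-∣ʳ c (n∣m*n r))
            (cong₂ ℕ._+_ (ℕ.m<n⇒m/n≡0 c<k) (ℕ.m*n/n≡m r k)))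
        , toℕ≡
        where
        u<n : c ℕ.+ r ℕ.* k ℕ.< n
        u<n = ℕ.≤-<-trans u≤w (Fin.toℕ<n w)
        toℕ≡ : toℕ (fromℕ< u<n) ≡ c ℕ.+ r ℕ.* k
        toℕ≡ = Fin.toℕ-fromℕ< u<n

    X Y X⁻ : Fin n → ℤ
    X v  = + col v - + 3 * + row v
    Y v  = + 3 * + col v + + row v
    X⁻ v = - X v

    -- Multiplication by 1 + 3i is undone, up to the norm 10, by multiplication by 1 - 3i: 10c = x +
    -- 3y and 10r = y - 3x.
    XY-injective : ∀ {u v} → X u ≡ X v → Y u ≡ Y v → u ≡ v
    XY-injective {u} {v} X≡ Y≡ = Fin.toℕ-injective (begin
      toℕ u                    ≡⟨ index u ⟩
      col u ℕ.+ row u ℕ.* k    ≡⟨ cong₂ (λ c r → c ℕ.+ r ℕ.* k) col≡ row≡ ⟩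
      col v ℕ.+ row v ℕ.* k    ≡⟨ index v ⟨
      toℕ v                    ∎)
      where
      open ≡-Reasoning
      row≡ : row u ≡ row v
      row≡ = +-injective (*-cancelˡ-≡ (+ 10) _ _ (trans (10r (+ col u) (+ row u))
        (trans (cong₂ (λ x y → y - + 3 * x) X≡ Y≡) (sym (10r (+ col v) (+ row v))))))
      col≡ : col u ≡ col v
      col≡ = +-injective (*-cancelˡ-≡ (+ 10) _ _ (trans (10c (+ col u) (+ row u))
        (trans (cong₂ (λ x y → x + + 3 * y) X≡ Y≡) (sym (10c (+ col v) (+ row v))))))

    module V = Lattice Y X
      (λ u v → + row u - + row v , slope-V (+ col u) (+ row u) (+ col v) (+ row v))
      (λ Y≡ X≡ → XY-injective X≡ Y≡)

    -- Reversing the horizontal axis turns the row step into (3 , 1), so both directions use the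
    -- same lattice.
    module H = Lattice X⁻ Y
      (λ u v → + col v - + col u , slope-H (+ col u) (+ row u) (+ col v) (+ row v))
      (λ X≡ Y≡ → XY-injective (neg-injective X≡) Y≡)

    vertex-≤ : ∀ c r w → c ℕ.≤ col w → r ℕ.≤ row w → ∃[ u ] col u ≡ c × row u ≡ r
    vertex-≤ c r w c≤ r≤ with u , c≡ , r≡ , _ ← vertex c r w (ℕ.≤-<-trans c≤ (col<k w))
      (subst (c ℕ.+ r ℕ.* k ℕ.≤_) (sym (index w)) (ℕ.+-mono-≤ c≤ (ℕ.*-monoˡ-≤ k r≤))) = u , c≡ , r≡

    -- Rows before that of `w` are complete, so the column may exceed that of `w`.
    vertex-< : ∀ c r w → c ℕ.< k → r ℕ.< row w → ∃[ u ] col u ≡ c × row u ≡ r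
    vertex-< c r w c<k r< with u , c≡ , r≡ , _ ← vertex c r w c<k
      (subst (c ℕ.+ r ℕ.* k ℕ.≤_) (sym (index w)) (let open ℕ.≤-Reasoning in begin
        c ℕ.+ r ℕ.* k             ≤⟨ ℕ.+-monoˡ-≤ (r ℕ.* k) (ℕ.<⇒≤ c<k) ⟩
        suc r ℕ.* k               ≤⟨ ℕ.*-monoˡ-≤ k r< ⟩
        row w ℕ.* k               ≤⟨ ℕ.m≤n+m _ (col w) ⟩
        col w ℕ.+ row w ℕ.* k     ∎)) = u , c≡ , r≡

    step-V3 : ∀ {u v} → col u ≡ suc (col v) → row u ≡ row v → Y u ≡ + 3 + Y v × X u ≡ 1ℤ + X v
    step-V3 {u} {v} c r rewrite c | r = y (+ col v) (+ row v) , x (+ col v) (+ row v)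
      where
      y : ∀ c r → + 3 * (1ℤ + c) + r ≡ + 3 + (+ 3 * c + r)
      y = ℤ.solve-∀
      x : ∀ c r → 1ℤ + c - + 3 * r ≡ 1ℤ + (c - + 3 * r)
      x = ℤ.solve-∀

    step-V7 : ∀ {u v} → col u ≡ 2 ℕ.+ col v → row u ≡ suc (row v) → Y u ≡ + 7 + Y v × X v ≡ 1ℤ + X u
    step-V7 {u} {v} c r rewrite c | r = y (+ col v) (+ row v) , x (+ col v) (+ row v)
      where
      y : ∀ c r → + 3 * (+ 2 + c) + (1ℤ + r) ≡ + 7 + (+ 3 * c + r)
      y = ℤ.solve-∀
      x : ∀ c r → c - + 3 * r ≡ 1ℤ + (+ 2 + c - + 3 * (1ℤ + r))
      x = ℤ.solve-∀

    step-H3 : ∀ {u v} → col u ≡ col v → row u ≡ suc (row v) → X⁻ u ≡ + 3 + X⁻ v × Y u ≡ 1ℤ + Y v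
    step-H3 {u} {v} c r rewrite c | r = x (+ col v) (+ row v) , y (+ col v) (+ row v)
      where
      x : ∀ c r → - (c - + 3 * (1ℤ + r)) ≡ + 3 + - (c - + 3 * r)
      x = ℤ.solve-∀
      y : ∀ c r → + 3 * c + (1ℤ + r) ≡ 1ℤ + (+ 3 * c + r)
      y = ℤ.solve-∀

    step-H7 : ∀ {u v} → col v ≡ suc (col u) → row u ≡ 2 ℕ.+ row v → X⁻ u ≡ + 7 + X⁻ v × Y v ≡ 1ℤ + Y u
    step-H7 {u} {v} c r rewrite c | r = x (+ col u) (+ row v) , y (+ col u) (+ row v)
      where
      x : ∀ c r → - (c - + 3 * (+ 2 + r)) ≡ + 7 + - (1ℤ + c - + 3 * r)
      x = ℤ.solve-∀
      y : ∀ c r → + 3 * (1ℤ + c) + r ≡ 1ℤ + (+ 3 * c + (+ 2 + r))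
      y = ℤ.solve-∀

    -- With equal x, the column difference is 3 times and the y difference 10 times the row
    -- difference.
    column-order : ∀ {v w} → X v ≡ X w → Y v < Y w → row v ℕ.< row w × 3 ℕ.+ col v ℕ.≤ col w
    column-order {v} {w} X≡ Y< = row< , drop‿+≤+ (begin
        + 3 + + col v                       ≡⟨ colEq (+ col v) (+ row v) ⟩
        X v + + 3 * (1ℤ + + row v)          ≤⟨ +-mono-≤ (≤-reflexive X≡)
                                                 (*-monoˡ-≤-nonNeg (+ 3) (+≤+ row<)) ⟩
        X w + + 3 * + row w                 ≡⟨ colEq′ (+ col w) (+ row w) ⟩
        + col w                             ∎)
      where
      open ≤-Reasoning
      row< : row v ℕ.< row w
      row< = drop‿+<+ (*-cancelˡ-<-nonNeg (+ 10) (subst₂ _<_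
        (sym (10r (+ col v) (+ row v))) (sym (10r (+ col w) (+ row w)))
        (+-mono-<-≤ Y< (≤-reflexive (cong (λ x → - (+ 3 * x)) X≡)))))
      colEq : ∀ c r → + 3 + c ≡ c - + 3 * r + + 3 * (1ℤ + r)
      colEq = ℤ.solve-∀
      colEq′ : ∀ c r → c - + 3 * r + + 3 * r ≡ c
      colEq′ = ℤ.solve-∀

    -- With equal y, the row difference is -3 times and the x difference 10 times the column
    -- difference.
    row-order : ∀ {v w} → Y v ≡ Y w → X⁻ v < X⁻ w → col w ℕ.< col v × 3 ℕ.+ row v ℕ.≤ row w
    row-order {v} {w} Y≡ X< = col< , drop‿+≤+ (begin
        + 3 + + row v                       ≡⟨ rowEq (+ col v) (+ row v) ⟩
        Y v + + 3 * (- (+ col v) + 1ℤ)      ≤⟨ +-mono-≤ (≤-reflexive Y≡)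
                                                 (*-monoˡ-≤-nonNeg (+ 3) bound) ⟩
        Y w + + 3 * - (+ col w)             ≡⟨ rowEq′ (+ col w) (+ row w) ⟩
        + row w                             ∎)
      where
      open ≤-Reasoning
      col< : col w ℕ.< col v
      col< = drop‿+<+ (*-cancelˡ-<-nonNeg (+ 10) (subst₂ _<_
        (sym (10c (+ col w) (+ row w))) (sym (10c (+ col v) (+ row v)))
        (+-mono-<-≤ (neg-cancel-< X<) (≤-reflexive (cong (+ 3 *_) (sym Y≡))))))
      bound : - (+ col v) + 1ℤ ≤ - (+ col w)
      bound = subst (_≤ - (+ col w)) (+-comm 1ℤ (- (+ col v)))
        (i<j⇒suc[i]≤j (neg-mono-< (+<+ col<)))
      rowEq : ∀ c r → + 3 + r ≡ + 3 * c + r + + 3 * (- c + 1ℤ)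
      rowEq = ℤ.solve-∀
      rowEq′ : ∀ c r → + 3 * c + r + + 3 * - c ≡ r
      rowEq′ = ℤ.solve-∀

    fill-V3 : ∀ {v w} → X v ≡ X w → Y v < Y w → ∃[ u ] Y u ≡ + 3 + Y v × X u ≡ 1ℤ + X v
    fill-V3 {v} {w} X≡ Y< =
      let r< , c≤ = column-order {v} {w} X≡ Y<
          u , c , r = vertex-≤ (suc (col v)) (row v) w (ℕ.≤-trans (ℕ.m≤n+m _ 2) c≤) (ℕ.<⇒≤ r<)
      in u , step-V3 {u} {v} c r

    fill-V7 : ∀ {v w} → X v ≡ X w → Y v < Y w → ∃[ u ] Y u ≡ + 7 + Y v × X v ≡ 1ℤ + X u
    fill-V7 {v} {w} X≡ Y< =
      let r< , c≤ = column-order {v} {w} X≡ Y<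
          u , c , r = vertex-≤ (2 ℕ.+ col v) (suc (row v)) w (ℕ.≤-trans (ℕ.m≤n+m _ 1) c≤) r<
      in u , step-V7 {u} {v} c r

    -- The new square lies to the right of the column of `w`, but in an earlier and hence complete
    -- row.
    fill-H3 : ∀ {v w} → Y v ≡ Y w → X⁻ v < X⁻ w → ∃[ u ] X⁻ u ≡ + 3 + X⁻ v × Y u ≡ 1ℤ + Y v
    fill-H3 {v} {w} Y≡ X< =
      let c< , r≤ = row-order {v} {w} Y≡ X<
          u , c , r = vertex-< (col v) (suc (row v)) w (col<k v) (ℕ.≤-trans (ℕ.m≤n+m _ 1) r≤)
      in u , step-H3 {u} {v} c r

    fill-H7 : ∀ {v w} → Y v ≡ Y w → X⁻ v < X⁻ w → ∃[ u ] X⁻ u ≡ + 7 + X⁻ v × Y v ≡ 1ℤ + Y u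
    fill-H7 {v} {w} Y≡ X< =
      let c< , r≤ = row-order {v} {w} Y≡ X<
          -- `col w ℕ.+ o` is the column just before `col v`.
          o , cv = ℕ.m≤n⇒∃[o]m+o≡n c<
          u , c , r = vertex-< (col w ℕ.+ o) (2 ℕ.+ row v) w
            (ℕ.<⇒≤ (subst (ℕ._< k) (sym cv) (col<k v))) r≤
      in u , step-H7 {u} {v} (trans (sym cv) (cong suc (sym c))) r

    module VF = V.Filled (λ {v} {w} → fill-V3 {v} {w}) (λ {v} {w} → fill-V7 {v} {w})
    module HF = H.Filled (λ {v} {w} → fill-H3 {v} {w}) (λ {v} {w} → fill-H7 {v} {w})

    visible-neg : ∀ {v w} → Visible X⁻ Y v w → Visible X Y v w
    visible-neg (c , cv , cw , free) = c , cv , cw , λ u cu → free u cu ∘ Sum.swap ∘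
      Sum.map (λ (p , q) → neg-mono-< q , neg-mono-< p) (λ (p , q) → neg-mono-< q , neg-mono-< p)

    visible-neg⁻ : ∀ {v w} → Visible X Y v w → Visible X⁻ Y v w
    visible-neg⁻ (c , cv , cw , free) = c , cv , cw , λ u cu → free u cu ∘ Sum.swap ∘
      Sum.map (λ (p , q) → neg-cancel-< q , neg-cancel-< p) (λ (p , q) → neg-cancel-< q , neg-cancel-< p)

    -- Every square is `Visible` from itself, hence the condition `v ≢ w`.
    Adjacent : Fin n → Fin n → Set
    Adjacent v w = v ≢ w × (Visible X Y v w ⊎ Visible Y X v w)

    graph : Graph n
    graph = record
      { Adj    = Adjacent
      ; adj?   = λ v w → ¬? (v Fin.≟ w) ×-dec (visible? X Y v w ⊎-dec visible? Y X v w)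
      ; symm   = λ (v≢w , vis) → v≢w ∘ sym , Sum.map (visible-sym X Y) (visible-sym Y X) vis
      ; irrefl = λ (v≢v , _) → v≢v refl
      }

    urvg : IsURVG graph
    urvg = halves X Y , halves-disjoint X Y separated , λ v w v≢w → mk⇔
      -- Transposing `halves X Y` gives `halves Y X` by computation, so vertical bands are
      -- `Visible Y X`.
      (λ (_ , vis) → Sum.map (visible⇒band X Y separated) (visible⇒band Y X V.separated) vis)
      (λ band → v≢w , Sum.map (band⇒visible X Y separated) (band⇒visible Y X V.separated) band)
      where
      separated : Separated X Y
      separated nearX nearY = V.separated nearY nearX

    colour : Fin n → Bool
    colour v = parity (X v)

    -- Y - X is the even number 2c + 4r. So a change of y by 1 across a horizontal band also changes
    -- the colour.
    colour-Y : ∀ v → parity (Y v) ≡ colour v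
    colour-Y v = trans (cong parity (rearrange (+ col v) (+ row v)))
      (trans (parity-2*+ (col v) _) (trans (parity-2*+ (row v) _) (parity-2*+ (row v) (X v))))
      where
      rearrange : ∀ c r → + 3 * c + r ≡ + 2 * c + (+ 2 * r + (+ 2 * r + (c - + 3 * r)))
      rearrange = ℤ.solve-∀

    colour-proper : Bipartite graph
    colour-proper = colour , proper
      where
      flip : ∀ {a b} → a ≡ 1ℤ + b → parity a ≢ parity b
      flip {b = b} refl e = not-¬ refl (trans (sym e) (parity-suc b))

      differ : ∀ {a b} → b ≡ 1ℤ + a ⊎ a ≡ 1ℤ + b → parity a ≢ parity b
      differ {a}     (inj₁ e) = flip {b = a} e ∘ sym
      differ {b = b} (inj₂ e) = flip {b = b} e

      proper : ∀ v w → Adjacent v w → colour v ≢ colour w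
      proper v w (v≢w , inj₂ vis) = differ {X v} {X w} (VF.visible-odd v≢w vis)
      proper v w (v≢w , inj₁ vis) same =
        differ {Y v} {Y w} (HF.visible-odd v≢w (visible-neg⁻ {v} {w} vis))
          (trans (colour-Y v) (trans same (sym (colour-Y w))))

-- Counting edges

module _ where
  open import Data.Nat.Base hiding (zero; suc; ℕ)
  open import Data.Nat.Properties

  lookup-injective : ∀ {A : Set} {xs : List A} → Unique xs →
                     ∀ i j → lookup xs i ≡ lookup xs j → i ≡ j
  lookup-injective (_   ∷ _)  zero    zero    _  = refl
  lookup-injective (x≢s ∷ _)  zero    (suc j) eq = contradiction eq (All.lookup x≢s (∈-lookup j))
  lookup-injective (x≢s ∷ _)  (suc i) zero    eq = contradiction (sym eq) (All.lookup x≢s (∈-lookup i))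
  lookup-injective (_   ∷ !s) (suc i) (suc j) eq = cong suc (lookup-injective !s i j eq)

  -- Pigeonhole: sending each position in `xs` to a position of the same entry in `ys` is injective.
  unique-⊆⇒length≤ : ∀ {A : Set} {xs ys : List A} → Unique xs →
                     (∀ {x} → x ∈ xs → x ∈ ys) → length xs ≤ length ys
  unique-⊆⇒length≤ {A} !xs xs⊆ys = Fin.injective⇒≤
    {f = λ i → Any.index (xs⊆ys (∈-lookup i))}
    (λ {i} {j} → lookup-injective !xs i j
      ∘ Setoid.index-injective (setoid A) (xs⊆ys (∈-lookup i)) (xs⊆ys (∈-lookup j)))

  length-cartesianProduct : ∀ {A B : Set} (xs : List A) (ys : List B) →
                            length (cartesianProduct xs ys) ≡ length xs * length ys
  length-cartesianProduct []       ys = refl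
  length-cartesianProduct (x ∷ xs) ys = trans (length-++ (map (x ,_) ys))
    (cong₂ _+_ (length-map (x ,_) ys) (length-cartesianProduct xs ys))

  listAll : ∀ {A : Set} → List (ℕ × (ℕ → A)) → List A
  listAll = concatMap (λ (m , f) → applyUpTo f m)

  length-listAll : ∀ {A : Set} (bs : List (ℕ × (ℕ → A))) → length (listAll bs) ≡ sum (map proj₁ bs)
  length-listAll []             = refl
  length-listAll ((m , f) ∷ bs) = trans (length-++ (applyUpTo f m))
    (cong₂ _+_ (length-applyUpTo f m) (length-listAll bs))

  ∈-listAll : ∀ {A : Set} {m} {f : ℕ → A} {bs} → (m , f) ∈ bs → ∀ {i} → i < m → f i ∈ listAll bs
  ∈-listAll (here refl) i<m = ∈-++⁺ˡ (∈-applyUpTo⁺ _ i<m)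
  ∈-listAll {bs = b ∷ _} (there ∈bs) i<m = ∈-++⁺ʳ _ (∈-listAll ∈bs i<m)

  -- The four steps and their exceptions

  module Count (n h : ℕ) (n≤k² : n ≤ (4 + h) * (4 + h)) where

    k : ℕ
    k = 4 + h

    open Brick n k

    edgeList : List (Fin n × Fin n)
    edgeList = filter (λ (v , w) → (v Fin.<? w) ×-dec Graph.adj? graph v w)
                      (cartesianProduct (allFin n) (allFin n))

    -- An edge is determined by its larger end and the difference of its ends.
    code : Fin n × Fin n → ℕ × ℕ
    code (u , v) = toℕ v ∸ toℕ u , toℕ v

    -- The steps (1 , 0), (0 , 1), (2 , 1) and (-1 , 2) in the numbering of the squares.
    shifts : List ℕ
    shifts = 1 ∷ k ∷ k + 2 ∷ k + (3 + h) ∷ []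

    -- Here `k` being at least 4 matters: for k = 3 the shifts k + 2 and 2k - 1 would coincide.
    shifts-unique : Unique shifts
    shifts-unique = ((λ ()) ∷ (λ ()) ∷ (λ ()) ∷ [])
      ∷ (<⇒≢ (m<m+n k (s≤s z≤n)) ∷ <⇒≢ (m<m+n k (s≤s z≤n)) ∷ [])
      ∷ ((λ eq → contradiction (+-cancelˡ-≡ k 2 (3 + h) eq) λ ()) ∷ [])
      ∷ [] ∷ []

    -- The pairs (δ , w) for which w ∸ δ is not a vertex joined to w, because w lies
    -- too close to the side or to the bottom of the arrangement.
    missing : List (ℕ × (ℕ → ℕ × ℕ))
    missing =
        (k , λ r → 1 , r * k)
      ∷ (k , λ c → k , c)
      ∷ (k , λ c → k + 2 , c)
      ∷ (3 + h , λ r → k + 2 , suc r * k)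
      ∷ (3 + h , λ r → k + 2 , 1 + suc r * k)
      ∷ (k , λ c → k + (3 + h) , c)
      ∷ (k , λ c → k + (3 + h) , c + 1 * k)
      ∷ (2 + h , λ r → k + (3 + h) , 3 + h + (2 + r) * k)
      ∷ []

    -- Five families of k pairs, two of k - 1 and one of k - 2.
    length-missing : length (listAll missing) + 4 ≡ 8 * k
    length-missing = trans (cong (_+ 4) (length-listAll missing)) (total h)
      where
      total : ∀ h → 4 + h + (4 + h + (4 + h + (3 + h + (3 + h + (4 + h + (4 + h + (2 + h + 0))))))) + 4
              ≡ 8 * (4 + h)
      total = ℕ.solve-∀

    row<k : ∀ v → row v < k
    row<k v = *-cancelʳ-< k (row v) k (begin-strict
      row v * k             ≤⟨ m≤n+m _ (col v) ⟩
      col v + row v * k     ≡⟨ index v ⟨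
      toℕ v                 <⟨ Fin.toℕ<n v ⟩
      n                     ≤⟨ n≤k² ⟩
      k * k                 ∎)
      where open ≤-Reasoning

    Present : ℕ → Fin n → Set
    Present δ v = (δ , toℕ v) ∈ map code edgeList ++ listAll missing

    absent : ∀ {m f v} → (m , f) ∈ missing → ∀ {i} → i < m → ∀ δ → (δ , toℕ v) ≡ f i → Present δ v
    absent f∈ i<m δ eq = ∈-++⁺ʳ (map code edgeList)
      (subst (_∈ listAll missing) (sym eq) (∈-listAll f∈ i<m))

    -- The position (c , r) is numbered before `v`, so `vertex` supplies the smaller end of the
    -- edge; a positive shift orients the pair as in `edges`.
    present : ∀ δ c r v → c < k → toℕ v ≡ suc δ + (c + r * k) →
              (∀ u → col u ≡ c → row u ≡ r → Visible X Y u v ⊎ Visible Y X u v) → Present (suc δ) v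
    present δ c r v c<k v≡ vis =
      let u , c≡ , r≡ , u≡ = vertex c r v c<k (≤-trans (m≤n+m _ (suc δ)) (≤-reflexive (sym v≡)))
          v≡δ+u = trans v≡ (cong (_+_ (suc δ)) (sym u≡))
          u<v = subst (toℕ u <_) (sym v≡δ+u) (s≤s (m≤n+m (toℕ u) δ))
      in ∈-++⁺ˡ (subst (λ d → (d , toℕ v) ∈ map code edgeList)
        (trans (cong (_∸ toℕ u) v≡δ+u) (m+n∸n≡m (suc δ) (toℕ u)))
        (∈-map⁺ code (∈-filter⁺ _ (∈-cartesianProduct⁺ (∈-allFin u) (∈-allFin v))
          (u<v , (λ u≡v → <⇒≢ u<v (cong toℕ u≡v)) , vis u c≡ r≡))))

    at : ∀ v {c r} → col v ≡ c → row v ≡ r → toℕ v ≡ c + r * k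
    at v c≡ r≡ = trans (index v) (cong₂ (λ c r → c + r * k) c≡ r≡)

    -- For families of exceptions that skip the first `m` rows and are indexed from 0.
    pred-row< : ∀ v {m r} → row v ≡ m + r → ∀ {l} → k ≡ m + l → r < l
    pred-row< v {m} {r} v≡ {l} k≡ = +-cancelˡ-< m r l (subst₂ _<_ v≡ k≡ (row<k v))

    present-1 : ∀ v → Present 1 v
    present-1 v = cases (col v) refl
      where
      cases : ∀ c → col v ≡ c → Present 1 v
      cases zero    c≡ = absent {v = v} (here refl) (row<k v) 1 (cong (1 ,_) (at v c≡ refl))
      cases (suc c) c≡ = present 0 c (row v) v (<⇒≤ (subst (_< k) c≡ (col<k v))) (at v c≡ refl)
        λ u cu ru → inj₂ (let p , q = step-V3 {v} {u} (trans c≡ (cong suc (sym cu))) (sym ru)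
                          in V.visible-3 {u} {v} p q)

    present-k : ∀ v → Present k v
    present-k v = cases (row v) refl
      where
      shift : ∀ c m k → c + (k + m) ≡ k + (c + m)
      shift = ℕ.solve-∀

      cases : ∀ r → row v ≡ r → Present k v
      cases zero    r≡ = absent {v = v} (there (here refl)) (col<k v) k
        (cong (k ,_) (trans (at v refl r≡) (+-identityʳ (col v))))
      cases (suc r) r≡ = present (3 + h) (col v) r v (col<k v)
        (trans (at v refl r≡) (shift (col v) (r * k) k))
        λ u cu ru → inj₁ (visible-neg {u} {v}
          (let p , q = step-H3 {v} {u} (sym cu) (trans r≡ (cong suc (sym ru)))
           in H.visible-3 {u} {v} p q))

    -- Stepping back by (2 , 1) leaves the arrangement from row 0 and from columns 0 and 1.
    present-k+2 : ∀ v → Present (k + 2) v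
    present-k+2 v = cases (row v) (col v) refl refl
      where
      shift : ∀ c m k → 2 + c + (k + m) ≡ k + 2 + (c + m)
      shift = ℕ.solve-∀

      cases : ∀ r c → row v ≡ r → col v ≡ c → Present (k + 2) v
      cases zero    _             r≡ _  = absent {v = v} (there (there (here refl))) (col<k v) (k + 2)
        (cong (k + 2 ,_) (trans (at v refl r≡) (+-identityʳ (col v))))
      cases (suc r) zero          r≡ c≡ = absent {v = v} (there (there (there (here refl))))
        (pred-row< v {1} r≡ refl) (k + 2) (cong (k + 2 ,_) (at v c≡ r≡))
      cases (suc r) (suc zero)    r≡ c≡ = absent {v = v} (there (there (there (there (here refl)))))
        (pred-row< v {1} r≡ refl) (k + 2) (cong (k + 2 ,_) (at v c≡ r≡))
      cases (suc r) (suc (suc c)) r≡ c≡ = present (3 + h + 2) c r v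
        (<⇒≤ (<⇒≤ (subst (_< k) c≡ (col<k v))))
        (trans (at v c≡ r≡) (shift c (r * k) k))
        λ u cu ru → inj₂ (let p , q = step-V7 {v} {u} (trans c≡ (cong (_+_ 2) (sym cu)))
                                                      (trans r≡ (cong suc (sym ru)))
                          in V.visible-7 {u} {v} p q)

    -- Stepping back by (-1 , 2) leaves the arrangement from rows 0 and 1 and from the last column.
    present-2k-1 : ∀ v → Present (k + (3 + h)) v
    present-2k-1 v = cases (row v) refl
      where
      δ : ℕ
      δ = k + (3 + h)

      shift : ∀ c m h → c + (4 + h + (4 + h + m)) ≡ 4 + h + (3 + h) + (suc c + m)
      shift = ℕ.solve-∀

      cases : ∀ r → row v ≡ r → Present δ v
      cases zero          r≡ = absent {v = v} (there (there (there (there (there (here refl))))))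
        (col<k v) δ (cong (δ ,_) (trans (at v refl r≡) (+-identityʳ (col v))))
      cases (suc zero)    r≡ = absent {v = v} (there (there (there (there (there (there (here refl)))))))
        (col<k v) δ (cong (δ ,_) (at v refl r≡))
      cases (suc (suc r)) r≡ with suc (col v) <? k
      ... | yes c<k = present (3 + h + (3 + h)) (suc (col v)) r v c<k
        (trans (at v refl r≡) (shift (col v) (r * k) h))
        λ u cu ru → inj₁ (visible-neg {u} {v}
          (let p , q = step-H7 {v} {u} cu (trans r≡ (cong (_+_ 2) (sym ru)))
           in H.visible-7 {u} {v} p q))
      ... | no  c≮k = absent {v = v} (there (there (there (there (there (there (there (here refl))))))))
        (pred-row< v {2} r≡ refl) δ
        (cong (δ ,_) (at v (suc-injective (≤-antisym (col<k v) (≮⇒≥ c≮k))) r≡))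

    all-present : ∀ {δv} → δv ∈ cartesianProduct shifts (upTo n) → δv ∈ map code edgeList ++ listAll missing
    all-present {δ , v} ∈T =
      let δ∈ , v∈ = ∈-cartesianProduct⁻ shifts (upTo n) ∈T
          v<n = ∈-upTo⁻ v∈
      in subst (λ w → (δ , w) ∈ map code edgeList ++ listAll missing) (Fin.toℕ-fromℕ< v<n)
           (cases δ∈ (fromℕ< v<n))
      where
      cases : ∀ {δ} → δ ∈ shifts → ∀ v → Present δ v
      cases (here refl)                         = present-1
      cases (there (here refl))                 = present-k
      cases (there (there (here refl)))         = present-k+2
      cases (there (there (there (here refl)))) = present-2k-1

    -- The 4n pairs of a shift and a vertex are distinct, and each is the code of an edge or one of
    -- the 8k - 4 exceptions.
    edge-count : 4 * n + 4 ≤ edges graph + 8 * k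
    edge-count = begin
      4 * n + 4
        ≡⟨ cong (λ m → 4 * m + 4) (length-upTo n) ⟨
      4 * length (upTo n) + 4
        ≡⟨ cong (_+ 4) (length-cartesianProduct shifts (upTo n)) ⟨
      length (cartesianProduct shifts (upTo n)) + 4
        ≤⟨ +-monoˡ-≤ 4 (unique-⊆⇒length≤ (cartesianProduct⁺ shifts-unique (upTo⁺ n)) all-present) ⟩
      length (map code edgeList ++ listAll missing) + 4
        ≡⟨ cong (_+ 4) (trans (length-++ (map code edgeList))
             (cong (_+ length (listAll missing)) (length-map code edgeList))) ⟩
      edges graph + length (listAll missing) + 4
        ≡⟨ +-assoc (edges graph) _ 4 ⟩
      edges graph + (length (listAll missing) + 4)
        ≡⟨ cong (_+_ (edges graph)) length-missing ⟩
      edges graph + 8 * k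
        ∎
      where open ≤-Reasoning

-- The bound over the integers

module _ where
  open import Data.Integer.Base using (_+_; _-_; _*_; _≤_)

  ℕ⇒ℤ-bound : ∀ n e k → 4 ℕ.* n ℕ.+ 4 ℕ.≤ e ℕ.+ 8 ℕ.* k → + 4 * + n - + 8 * + k + + 4 ≤ + e
  ℕ⇒ℤ-bound n e k p = begin
    + 4 * + n - + 8 * + k + + 4            ≡⟨ move (+ 4 * + n) (+ 8 * + k) ⟩
    + 4 * + n + + 4 - + 8 * + k            ≡⟨ cong (λ i → i + + 4 - + 8 * + k) (ℤ.pos-* 4 n) ⟨
    + (4 ℕ.* n ℕ.+ 4) - + 8 * + k          ≤⟨ ℤ.+-monoˡ-≤ (ℤ.- (+ 8 * + k)) (ℤ.+≤+ p) ⟩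
    + e + + (8 ℕ.* k) - + 8 * + k          ≡⟨ cong (λ i → + e + i - + 8 * + k) (ℤ.pos-* 8 k) ⟩
    + e + + 8 * + k - + 8 * + k            ≡⟨ cancel (+ e) (+ 8 * + k) ⟩
    + e                                    ∎
    where
    open ℤ.≤-Reasoning
    move : ∀ a b → a - b + + 4 ≡ a + + 4 - b
    move = ℤ.solve-∀
    cancel : ∀ a b → a + b - b ≡ a
    cancel = ℤ.solve-∀

dense-graph : ∀ n k → 4 ℕ.≤ k → n ℕ.≤ k ℕ.* k →
              Σ (Graph n) λ G → Bipartite G × IsURVG G × 4 ℕ.* n ℕ.+ 4 ℕ.≤ edges G ℕ.+ 8 ℕ.* k
dense-graph n k 4≤k n≤k² with h , refl ← ℕ.m≤n⇒∃[o]m+o≡n 4≤k =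
  graph , colour-proper , urvg , Count.edge-count n h n≤k²
  where open Brick n k

open import Data.Integer.Base using (_+_; _-_; _*_; _≥_)

theorem6p7 : ∀ (n : ℕ) → n ℕ.≥ 81 →
    Σ (Graph n) λ G →
    Bipartite G × IsURVG G ×
    + edges G ≥ + 4 * + n - + 8 * + ⌈√ n ⌉ + + 4
theorem6p7 n n≥81 =
  let G , bipartite , urvg , count = dense-graph n ⌈√ n ⌉ (ℕ.≰⇒> 4≰) (⌈√⌉-upper n)
  in G , bipartite , urvg , ℕ⇒ℤ-bound n (edges G) ⌈√ n ⌉ count
  where
  4≰ : ¬ ⌈√ n ⌉ ℕ.≤ 3
  -- A root of at most 3 would give n ≤ 9, against 10 ≤ 81 ≤ n.
  4≰ ≤3 = ℕ.<⇒≱ (ℕ.≤-trans (ℕ.m≤m+n 10 71) n≥81)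
    (ℕ.≤-trans (⌈√⌉-upper n) (ℕ.*-mono-≤ ≤3 ≤3))
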